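{- Let $p$ be a positive integer and let $G$ be a $\{\text{butterfly},\text{hammer},P_4+K_p\}$-free graph such that no connected component of $G$ has clique number two. Then $$\chi(G)\leq \begin{cases} \omega(G)+\frac{p(p+1)}{2} & \text{if } 1\leq \omega(G)\leq p+1,\\ \omega(G)+\frac{p(p+1)}{2}-1 & \text{if } \omega(G)\geq p+2.\end{cases}$$
   Context: All graphs are simple, finite and undirected. $\omega(G)$ is the clique number and $\chi(G)$ the chromatic number of $G$. For a family $\mathcal{F}$ of graphs, $G$ is $\mathcal{F}$-free if it has no induced subgraph isomorphic to a member of $\mathcal{F}$. The butterfly is the graph on five vertices consisting of two triangles sharing exactly one vertex (with no other edges). The hammer is the graph on five vertices $a,b,c,d,e$ with edges $ab,bc,ac,cd,de$. $P_4$ is the path on four vertices and $K_p$ the complete graph on $p$ vertices. For vertex-disjoint graphs $G_1,G_2$, the join $G_1+G_2$ is obtained from their disjoint union by adding all edges between $V(G_1)$ and $V(G_2)$. -}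

module Defs where

open import Data.Fin.Base using (Fin; zero; suc; splitAt)
open import Data.Fin.Patterns using (0F; 1F; 2F; 3F; 4F)
open import Data.Fin.Properties using (_≟_)
open import Data.Fin.Subset using (Subset; _∈_; _⊆_; ∣_∣; Nonempty) renaming (⊤ to full)
open import Data.List.Base using (List; []; _∷_)
open import Data.List.Membership.Propositional using () renaming (_∈_ to _∈ₗ_)
import Data.List.Membership.DecPropositional as DecMembership
open import Data.List.Relation.Unary.All as All using (All)
open import Data.Nat.Base using (ℕ; _+_; _≤_)
open import Data.Product.Base using (Σ; ∃; ∃-syntax; _×_; _,_)
open import Data.Product.Properties using (≡-dec)
open import Data.Sum.Base using (_⊎_; inj₁; inj₂; swap; reduce)
open import Data.Unit.Base using (⊤; tt)
open import Function.Base using (_on_)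
open import Function.Bundles using (_⇔_)
open import Function.Definitions using (Injective)
open import Level using (0ℓ)
open import Relation.Binary.Construct.Closure.ReflexiveTransitive using (Star)
open import Relation.Binary.Core using (Rel)
open import Relation.Binary.Definitions using (Symmetric; Decidable)
open import Relation.Binary.PropositionalEquality using (_≡_; _≢_; refl; ≢-sym)
open import Relation.Nullary.Decidable using (True; toWitness; yes; ¬?; _⊎-dec_)
open import Relation.Nullary.Negation using (¬_)

-- Decidability of adjacency holds classically for every graph; it is recorded
-- here because a finite graph is meant to be given by explicit finite data.
record Graph (n : ℕ) : Set₁ where
  field
    Adj       : Rel (Fin n) 0ℓ
    Adj-sym   : Symmetric Adj
    Adj-irr   : ∀ x → ¬ Adj x x
    _Adj?_    : Decidable Adj

open Graph public

fromEdges : ∀ {n} (E : List (Fin n × Fin n)) →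
            {True (All.all? (λ { (i , j) → ¬? (i ≟ j) }) E)} → Graph n
fromEdges {n} E {loopless} = record
  { Adj     = λ i j → (i , j) ∈ₗ E ⊎ (j , i) ∈ₗ E
  ; Adj-sym = swap
  ; Adj-irr = λ x e → All.lookup (toWitness loopless) (reduce e) refl
  ; _Adj?_  = λ i j → ((i , j) ∈? E) ⊎-dec ((j , i) ∈? E)
  }
  where open DecMembership (≡-dec (_≟_ {n}) _≟_) using (_∈?_)

butterfly : Graph 5
butterfly = fromEdges ( (0F , 1F) ∷ (0F , 2F) ∷ (1F , 2F)
                      ∷ (0F , 3F) ∷ (0F , 4F) ∷ (3F , 4F) ∷ [] )

hammer : Graph 5
hammer = fromEdges ( (0F , 1F) ∷ (1F , 2F) ∷ (0F , 2F)
                   ∷ (2F , 3F) ∷ (3F , 4F) ∷ [] )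

P₄ : Graph 4
P₄ = fromEdges ((0F , 1F) ∷ (1F , 2F) ∷ (2F , 3F) ∷ [])

K : (p : ℕ) → Graph p
K p = record
  { Adj     = _≢_
  ; Adj-sym = ≢-sym
  ; Adj-irr = λ x x≢x → x≢x refl
  ; _Adj?_  = λ i j → ¬? (i ≟ j)
  }

JoinAdj : ∀ {m n} → Graph m → Graph n → Rel (Fin m ⊎ Fin n) 0ℓ
JoinAdj G H (inj₁ i) (inj₁ j) = Adj G i j
JoinAdj G H (inj₁ _) (inj₂ _) = ⊤
JoinAdj G H (inj₂ _) (inj₁ _) = ⊤
JoinAdj G H (inj₂ i) (inj₂ j) = Adj H i j

-- The first m vertices of the join carry G, the remaining n carry H.
join : ∀ {m n} → Graph m → Graph n → Graph (m + n)
join {m} {n} G H = record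
  { Adj     = JoinAdj G H on splitAt m
  ; Adj-sym = λ {i} {j} → symJ (splitAt m i) (splitAt m j)
  ; Adj-irr = λ i → irrJ (splitAt m i)
  ; _Adj?_  = λ i j → decJ (splitAt m i) (splitAt m j)
  }
  where
  symJ : ∀ x y → JoinAdj G H x y → JoinAdj G H y x
  symJ (inj₁ _) (inj₁ _) e = Adj-sym G e
  symJ (inj₁ _) (inj₂ _) _ = tt
  symJ (inj₂ _) (inj₁ _) _ = tt
  symJ (inj₂ _) (inj₂ _) e = Adj-sym H e

  irrJ : ∀ x → ¬ JoinAdj G H x x
  irrJ (inj₁ i) = Adj-irr G i
  irrJ (inj₂ i) = Adj-irr H i

  decJ : Decidable (JoinAdj G H)
  decJ (inj₁ i) (inj₁ j) = _Adj?_ G i j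
  decJ (inj₁ _) (inj₂ _) = yes tt
  decJ (inj₂ _) (inj₁ _) = yes tt
  decJ (inj₂ i) (inj₂ j) = _Adj?_ H i j

-- H is isomorphic to an induced subgraph of G, namely the one induced on the
-- image of f.
InducedIn : ∀ {m n} → Graph m → Graph n → Set
InducedIn {m} {n} H G =
  Σ (Fin m → Fin n) λ f →
    Injective _≡_ _≡_ f × (∀ i j → Adj H i j ⇔ Adj G (f i) (f j))

Free : ∀ {n} → List (∃ Graph) → Graph n → Set₁
Free 𝓕 G = All (λ { (_ , H) → ¬ InducedIn H G }) 𝓕

IsClique : ∀ {n} → Graph n → Subset n → Set
IsClique G Q = ∀ {x y} → x ∈ Q → y ∈ Q → x ≢ y → Adj G x y

-- k is the clique number of the subgraph of G induced on S: the cliques of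
-- that subgraph are exactly the cliques of G contained in S.
IsCliqueNumberOn : ∀ {n} → Graph n → Subset n → ℕ → Set
IsCliqueNumberOn G S k =
  (∃[ Q ] Q ⊆ S × IsClique G Q × ∣ Q ∣ ≡ k) ×
  (∀ Q → Q ⊆ S → IsClique G Q → ∣ Q ∣ ≤ k)

IsCliqueNumber : ∀ {n} → Graph n → ℕ → Set
IsCliqueNumber G = IsCliqueNumberOn G full

Colourable : ∀ {n} → Graph n → ℕ → Set
Colourable {n} G k =
  Σ (Fin n → Fin k) λ c → ∀ {x y} → Adj G x y → c x ≢ c y

IsChromaticNumber : ∀ {n} → Graph n → ℕ → Set
IsChromaticNumber G k = Colourable G k × (∀ m → Colourable G m → k ≤ m)

-- C is the vertex set of a connected component; Star (Adj G) x y is the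
-- existence of a walk from x to y.
IsComponent : ∀ {n} → Graph n → Subset n → Set
IsComponent G C =
  Nonempty C × (∀ {x} → x ∈ C → ∀ y → y ∈ C ⇔ Star (Adj G) x y)

{-# OPTIONS --safe #-}
module Submission where

-- Let A be a maximum clique of a component, ∣A∣ = k ≥ 3 (k = 1 is trivial), and
-- for a vertex x let N(x) ⊆ A be its nonneighbours in A; it is nonempty.
-- Excluding butterfly and hammer forces ∣N(x) ∩ N(y)∣ ≤ 1 for adjacent x, y, so
-- vertices sharing a fixed pair in N(x) form an independent set.  If k ≤ p + 1,
-- colour x by i when N(x) = {i} and by a pair in N(x) otherwise: k + C(k,2)
-- colours.  If k ≥ p + 2, excluding P₄ + K_p makes x, y nonadjacent as soon as
-- N(x) ∩ N(y) is nonempty and they have p common neighbours in A.  Only pairs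
-- i < j among the first p + 1 clique vertices with i among the first p − 1 then
-- need a new colour, which is C(p+1,2) − 1 pairs; all other vertices can reuse
-- a colour of A.

open import Data.List.Base using ([]; _∷_)
open import Data.Nat.Base using (ℕ; _+_; _*_; _∸_; _≤_)
open import Data.Nat.DivMod using (_/_)
open import Data.Product.Base using (_×_; _,_)
open import Relation.Nullary.Negation using (¬_)
open import Defs

open import Data.Bool.Base using (Bool; true; false)
import Data.Bool.Properties as Bool
open import Data.Empty using (⊥; ⊥-elim)
open import Data.Fin.Base
  using ( Fin; zero; suc; toℕ; _<_; splitAt; _↑ˡ_; _↑ʳ_; punchIn; punchOut
        ; inject₁; inject≤; fromℕ; fromℕ<)
open import Data.Fin.Induction using (<-weakInduction; >-weakInduction)
open import Data.Fin.Patterns using (0F; 1F; 2F; 3F; 4F)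
open import Data.Fin.Properties as Fin using (_≟_; any?; all?; <-cmp; ¬∀⟶∃¬)
open import Data.Fin.Subset using (Subset; inside; outside; _∈_; _⊆_; ∣_∣; _-_) renaming (⊥ to ∅)
open import Data.Fin.Subset.Properties
  using (_∈?_; _⊆?_; anySubset?; ⊆⊤; ∉⊥; ∣⊥∣≡0; x∈p⇒∣p-x∣<∣p∣; x∈p∧x≢y⇒x∈p-y)
open import Data.List.Base using (List; allFin; cartesianProduct)
open import Data.List.Membership.Propositional using () renaming (_∈_ to _∈ₗ_)
open import Data.List.Membership.Propositional.Properties using (∈-allFin; ∈-cartesianProduct⁺)
open import Data.List.Relation.Unary.All using (_∷_)
open import Data.List.Relation.Unary.Any using (here; there)
open import Data.Nat.Base as ℕ using (z≤n; s≤s)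
open import Data.Nat.DivMod using (m*n/n≡m)
import Data.Nat.Properties as ℕ
open import Data.Nat.Tactic.RingSolver using (solve-∀)
open import Data.Product.Base using (Σ; ∃; ∃-syntax; ∃₂; proj₁; proj₂)
open import Data.Sum.Base using (_⊎_; inj₁; inj₂; [_,_]′; map₁)
open import Data.Sum.Properties using (inj₁-injective; inj₂-injective)
open import Data.Unit.Base using (⊤; tt)
import Data.Vec.Base as Vec
open import Data.Vec.Properties using (lookup∘tabulate; []=⇒lookup; lookup⇒[]=)
open import Function.Base using (_∘_; id; case_of_)
open import Function.Bundles using (_⇔_; mk⇔; Equivalence)
open import Function.Definitions using (Injective)
open import Level using (0ℓ)
open import Relation.Binary.Construct.Closure.ReflexiveTransitive using (Star; ε; _◅_; _◅◅_)
open import Relation.Binary.Definitions using (tri<; tri≈; tri>)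
open import Relation.Binary.PropositionalEquality
  using (_≡_; _≢_; refl; sym; trans; cong; subst; ≢-sym)
open import Relation.Nullary.Decidable
  using ( Dec; yes; no; does; does-⇔; True; toWitness; ¬?; _×-dec_; _⊎-dec_; _→-dec_
        ; decidable-stable; map′; dec-true)
open import Relation.Nullary.Negation using (contradiction)
open import Relation.Unary as U using (Pred)

-- Recognising induced subgraphs.

TwinFree : ∀ {m} → Graph m → Set
TwinFree H = ∀ i j → i ≡ j ⊎ ∃[ l ] does (_Adj?_ H i l) ≢ does (_Adj?_ H j l)

twinFree? : ∀ {m} (H : Graph m) → Dec (TwinFree H)
twinFree? H = all? λ i → all? λ j →
  (i ≟ j) ⊎-dec any? λ l → ¬? (does (_Adj?_ H i l) Bool.≟ does (_Adj?_ H j l))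

module _ {n : ℕ} (G : Graph n) where

  SameAdj : ∀ {m} → Graph m → (Fin m → Fin n) → Set
  SameAdj H f = ∀ i j → Adj H i j ⇔ Adj G (f i) (f j)

  -- If `f i ≡ f j`, then i and j have the same neighbours in `H`, which twin-freeness allows only
  -- for i = j. Injectivity thus comes for free, and for a concrete `H` the hypothesis is settled by
  -- evaluation in `inducedIn`.
  twinFree⇒injective : ∀ {m} {H : Graph m} {f : Fin m → Fin n} →
                       TwinFree H → SameAdj H f → Injective _≡_ _≡_ f
  twinFree⇒injective {H = H} {f} tf same {i} {j} fi≡fj with tf i j
  ... | inj₁ i≡j = i≡j
  ... | inj₂ (l , differ) = contradiction
          (trans (does-⇔ (same i l) (_Adj?_ H i l) (_Adj?_ G (f i) (f l)))
            (trans (cong (λ x → does (_Adj?_ G x (f l))) fi≡fj)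
              (sym (does-⇔ (same j l) (_Adj?_ H j l) (_Adj?_ G (f j) (f l))))))
          differ

  AdjIff : Bool → Fin n → Fin n → Set
  AdjIff true  x y = Adj G x y
  AdjIff false x y = ¬ Adj G x y

  -- Only entries above the diagonal are demanded, row by row; symmetry and irreflexivity supply the
  -- others. For a concrete table each entry computes to an adjacency or its negation.
  Induces : ∀ {m} → (Fin m → Fin m → Bool) → (Fin m → Fin n) → Set
  Induces {ℕ.zero} b f = ⊤
  Induces {ℕ.suc m} b f =
    (∀ j → AdjIff (b zero (suc j)) (f zero) (f (suc j))) ×
    Induces (λ i j → b (suc i) (suc j)) (f ∘ suc)

  induces-< : ∀ {m} {b} {f : Fin m → Fin n} → Induces b f →
              ∀ {i j} → i < j → AdjIff (b i j) (f i) (f j)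
  induces-< (row , _) {zero} {suc j} _ = row j
  induces-< (_ , rows) {suc i} {suc j} (s≤s i<j) = induces-< rows i<j

  adjIff⇒⇔ : ∀ {P : Set} {x y} (P? : Dec P) → AdjIff (does P?) x y → P ⇔ Adj G x y
  adjIff⇒⇔ (yes p) xy = mk⇔ (λ _ → xy) (λ _ → p)
  adjIff⇒⇔ (no ¬p) ¬xy = mk⇔ (λ p → contradiction p ¬p) (λ xy → contradiction xy ¬xy)

  induces⇒sameAdj : ∀ {m} (H : Graph m) (f : Fin m → Fin n) →
                    Induces (λ i j → does (_Adj?_ H i j)) f → SameAdj H f
  induces⇒sameAdj H f ind i j with <-cmp i j
  ... | tri< i<j _ _ = adjIff⇒⇔ (_Adj?_ H i j) (induces-< ind i<j)
  ... | tri≈ _ refl _ = mk⇔ (⊥-elim ∘ Adj-irr H i) (⊥-elim ∘ Adj-irr G (f i))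
  ... | tri> _ _ j<i =
    let ji = adjIff⇒⇔ (_Adj?_ H j i) (induces-< ind j<i)
    in mk⇔ (Adj-sym G ∘ Equivalence.to ji ∘ Adj-sym H)
           (Adj-sym H ∘ Equivalence.from ji ∘ Adj-sym G)

  inducedIn : ∀ {m} (H : Graph m) {tf : True (twinFree? H)} (f : Fin m → Fin n) →
              Induces (λ i j → does (_Adj?_ H i j)) f → InducedIn H G
  inducedIn H {tf} f ind =
    f , twinFree⇒injective {H = H} (toWitness tf) same , same
    where same = induces⇒sameAdj H f ind

  quad : Fin n → Fin n → Fin n → Fin n → Fin 4 → Fin n
  quad a b c d = λ { 0F → a ; 1F → b ; 2F → c ; 3F → d }

  quint : Fin n → Fin n → Fin n → Fin n → Fin n → Fin 5 → Fin n
  quint a b c d e = λ { 0F → a ; 1F → b ; 2F → c ; 3F → d ; 4F → e }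


  -- A coincidence between the two sides, or between two clique vertices, would turn a required edge
  -- into a loop. Only inside `H` is the injectivity of the given embedding needed.
  join-K-inducedIn : ∀ {m p} {H : Graph m} (H⊆G : InducedIn H G) (g : Fin p → Fin n) →
                     (∀ {i j} → i ≢ j → Adj G (g i) (g j)) →
                     (∀ i l → Adj G (proj₁ H⊆G i) (g l)) →
                     InducedIn (join H (K p)) G
  join-K-inducedIn {m} {p} {H} (f , f-inj , f-same) g g-clique fg =
    F ∘ splitAt m , (λ {i} {j} → injective i j) , λ i j → same (splitAt m i) (splitAt m j)
    where
    F : Fin m ⊎ Fin p → Fin n
    F = [ f , g ]′

    same : ∀ s t → JoinAdj H (K p) s t ⇔ Adj G (F s) (F t)
    same (inj₁ i) (inj₁ j) = f-same i j
    same (inj₁ i) (inj₂ l) = mk⇔ (λ _ → fg i l) (λ _ → tt)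
    same (inj₂ l) (inj₁ i) = mk⇔ (λ _ → Adj-sym G (fg i l)) (λ _ → tt)
    same (inj₂ l) (inj₂ r) = mk⇔ g-clique λ { gg refl → Adj-irr G (g l) gg }

    F-injective : ∀ s t → F s ≡ F t → s ≡ t
    F-injective (inj₁ i) (inj₁ j) eq = cong inj₁ (f-inj eq)
    F-injective (inj₁ i) (inj₂ l) eq =
      ⊥-elim (Adj-irr G (g l) (subst (λ x → Adj G x (g l)) eq (fg i l)))
    F-injective (inj₂ l) (inj₁ i) eq =
      ⊥-elim (Adj-irr G (g l) (subst (λ x → Adj G x (g l)) (sym eq) (fg i l)))
    F-injective (inj₂ l) (inj₂ r) eq with l ≟ r
    ... | yes l≡r = cong inj₂ l≡r
    ... | no l≢r =
      ⊥-elim (Adj-irr G (g r) (subst (λ x → Adj G x (g r)) eq (g-clique l≢r)))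

    injective : ∀ i j → F (splitAt m i) ≡ F (splitAt m j) → i ≡ j
    injective i j eq =
      trans (sym (Fin.join-splitAt m p i))
        (trans (cong (Data.Fin.Base.join m p) (F-injective (splitAt m i) (splitAt m j) eq))
          (Fin.join-splitAt m p j))

  -- Forbidden configurations.

  module _ (noButterfly : ¬ InducedIn butterfly G) (noHammer : ¬ InducedIn hammer G) where

    -- The pair c, y decides: an edge gives triangles abc and cxy meeting in c, a butterfly; a
    -- non-edge gives the triangle abc with tail x, y, a hammer.
    noPendantPath : ∀ {a b c x y} → Adj G a b → Adj G a c → Adj G b c →
                    Adj G c x → Adj G x y →
                    ¬ Adj G a x → ¬ Adj G b x → ¬ Adj G a y → ¬ Adj G b y → ⊥
    noPendantPath {a} {b} {c} {x} {y} ab ac bc cx xy ¬ax ¬bx ¬ay ¬by with _Adj?_ G c y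
    ... | yes cy = noButterfly (inducedIn butterfly (quint c a b x y)
          ( (λ { 0F → Adj-sym G ac ; 1F → Adj-sym G bc ; 2F → cx ; 3F → cy })
          , (λ { 0F → ab ; 1F → ¬ax ; 2F → ¬ay })
          , (λ { 0F → ¬bx ; 1F → ¬by })
          , (λ { 0F → xy }) , (λ ()) , tt ))
    ... | no ¬cy = noHammer (inducedIn hammer (quint a b c x y)
          ( (λ { 0F → ab ; 1F → ac ; 2F → ¬ax ; 3F → ¬ay })
          , (λ { 0F → bc ; 1F → ¬bx ; 2F → ¬by })
          , (λ { 0F → cx ; 1F → ¬cy })
          , (λ { 0F → xy }) , (λ ()) , tt ))

  noP₄InCommonNbhd : ∀ {p} → ¬ InducedIn (join P₄ (K p)) G →
    ∀ {a b c d} → Adj G a b → Adj G b c → Adj G c d →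
    ¬ Adj G a c → ¬ Adj G a d → ¬ Adj G b d →
    (g : Fin p → Fin n) → (∀ {i j} → i ≢ j → Adj G (g i) (g j)) →
    (∀ l → Adj G a (g l)) → (∀ l → Adj G b (g l)) →
    (∀ l → Adj G c (g l)) → (∀ l → Adj G d (g l)) → ⊥
  noP₄InCommonNbhd free {a} {b} {c} {d} ab bc cd ¬ac ¬ad ¬bd g clique ag bg cg dg =
    free (join-K-inducedIn
      (inducedIn P₄ (quad a b c d)
        ( (λ { 0F → ab ; 1F → ¬ac ; 2F → ¬ad })
        , (λ { 0F → bc ; 1F → ¬bd }) , (λ { 0F → cd }) , (λ ()) , tt ))
      g clique (λ { 0F → ag ; 1F → bg ; 2F → cg ; 3F → dg }))

-- Triangular numbers and the coding of pairs.

tri : ℕ → ℕ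
tri ℕ.zero = 0
tri (ℕ.suc j) = tri j ℕ.+ j

tri-mono : ∀ {i j} → i ℕ.≤ j → tri i ℕ.≤ tri j
tri-mono z≤n = z≤n
tri-mono (s≤s i≤j) = ℕ.+-mono-≤ (tri-mono i≤j) i≤j

tri-+-< : ∀ {i j m} → i ℕ.< j → j ℕ.< m → tri j ℕ.+ i ℕ.< tri m
tri-+-< {i} {j} i<j j<m = ℕ.<-≤-trans (ℕ.+-monoʳ-< (tri j) i<j) (tri-mono j<m)

-- `tri j` is C(j,2), and the code of i < j is its colexicographic rank: pairs with larger entry j
-- fill the interval from `tri j` up to `tri (suc j)`, and these intervals are disjoint.
tri-+-injective : ∀ {i j i′ j′} → i ℕ.< j → i′ ℕ.< j′ →
                  tri j ℕ.+ i ≡ tri j′ ℕ.+ i′ → i ≡ i′ × j ≡ j′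
tri-+-injective {i} {j} {i′} {j′} i<j i′<j′ eq with ℕ.<-cmp j j′
... | tri< j<j′ _ _ =
  contradiction eq (ℕ.<⇒≢ (ℕ.<-≤-trans (tri-+-< i<j j<j′) (ℕ.m≤m+n (tri j′) i′)))
... | tri≈ _ refl _ = ℕ.+-cancelˡ-≡ (tri j) i i′ eq , refl
... | tri> _ _ j′<j =
  contradiction (sym eq) (ℕ.<⇒≢ (ℕ.<-≤-trans (tri-+-< i′<j′ j′<j) (ℕ.m≤m+n (tri j) i)))

-- Choosing indices in a finite range.

prev : ∀ {m} → Fin (ℕ.suc m) → Fin (ℕ.suc m)
prev {m} zero = fromℕ m
prev (suc i) = inject₁ i

-- `prev` is the predecessor on a cycle: descend from the given element to zero, wrap around to the
-- largest, and descend again through every index.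
prev-closed⇒all : ∀ {m} (D : Pred (Fin (ℕ.suc m)) 0ℓ) →
                  (∀ i → D i → D (prev i)) → ∃ D → ∀ i → D i
prev-closed⇒all D closed (i , Di) =
  >-weakInduction D (closed zero (descend i Di)) (λ j → closed (suc j))
  where
  descend : ∀ i → D i → D zero
  descend = <-weakInduction (λ i → D i → D zero) id (λ i ih → ih ∘ closed (suc i))

all-or-boundary : ∀ {m} {D : Pred (Fin (ℕ.suc m)) 0ℓ} → U.Decidable D → ∃ D →
                  (∀ i → D i) ⊎ ∃[ i ] D i × ¬ D (prev i)
all-or-boundary {D = D} D? nonempty with any? (λ i → D? i ×-dec ¬? (D? (prev i)))
... | yes boundary = inj₂ boundary
... | no none = inj₁ (prev-closed⇒all D
        (λ i Di → decidable-stable (D? (prev i)) λ ¬D → none (i , Di , ¬D)) nonempty)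

-- Two of any three indices agree on `P`. Distinct i and j exclude k ≤ 1, so `k ≢ 2` supplies the
-- third index; this is where components of clique number two are ruled out.
two-alike : ∀ {k} → k ≢ 2 → ∀ {P : Pred (Fin k) 0ℓ} → U.Decidable P →
            ∀ {i j : Fin k} → i ≢ j →
            (∃₂ λ a b → a ≢ b × P a × P b) ⊎ (∃₂ λ a b → a ≢ b × ¬ P a × ¬ P b)
two-alike {1} _ P? {0F} {0F} i≢j = contradiction refl i≢j
two-alike {2} 2≢2 = contradiction refl 2≢2
two-alike {ℕ.suc (ℕ.suc (ℕ.suc _))} _ P? _ with P? 0F | P? 1F | P? 2F
... | yes p | yes q | _     = inj₁ (0F , 1F , (λ ()) , p , q)
... | yes p | no _  | yes r = inj₁ (0F , 2F , (λ ()) , p , r)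
... | no _  | yes q | yes r = inj₁ (1F , 2F , (λ ()) , q , r)
... | no p  | no q  | _     = inj₂ (0F , 1F , (λ ()) , p , q)
... | no p  | yes _ | no r  = inj₂ (0F , 2F , (λ ()) , p , r)
... | yes _ | no q  | no r  = inj₂ (1F , 2F , (λ ()) , q , r)

avoid-two : ∀ {p k} → 2 ℕ.+ p ℕ.≤ k → {i j : Fin k} → i ≢ j →
  Σ (Fin p → Fin k) λ h → (∀ {l r} → l ≢ r → h l ≢ h r) × (∀ l → h l ≢ i) × (∀ l → h l ≢ j)
avoid-two {k = ℕ.suc (ℕ.suc k)} (s≤s (s≤s p≤k)) {i} {j} i≢j =
  (λ l → punchIn i (punchIn j′ (inject≤ l p≤k))) ,
  (λ l≢r eq → l≢r (Fin.inject≤-injective p≤k p≤k _ _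
    (Fin.punchIn-injective j′ _ _ (Fin.punchIn-injective i _ _ eq)))) ,
  (λ l → Fin.punchInᵢ≢i i _) ,
  (λ l eq → Fin.punchInᵢ≢i j′ (inject≤ l p≤k)
    (Fin.punchIn-injective i _ _ (trans eq (sym (Fin.punchIn-punchOut i≢j)))))
  where j′ = punchOut i≢j

avoid-one : ∀ {p k} → ℕ.suc p ℕ.≤ k → {i : Fin k} → toℕ i ℕ.< ℕ.suc p →
  Σ (Fin p → Fin k) λ h →
    (∀ {l r} → l ≢ r → h l ≢ h r) × (∀ l → h l ≢ i) × (∀ l → toℕ (h l) ℕ.< ℕ.suc p)
avoid-one {p} {k} 1+p≤k {i} i<1+p =
  (λ l → inject≤ (punchIn i′ l) 1+p≤k) ,
  (λ l≢r eq → l≢r (Fin.punchIn-injective i′ _ _ (Fin.inject≤-injective 1+p≤k 1+p≤k _ _ eq))) ,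
  (λ l eq → Fin.punchInᵢ≢i i′ l (Fin.toℕ-injective
    (trans (sym (Fin.toℕ-inject≤ _ 1+p≤k)) (trans (cong toℕ eq) (sym (Fin.toℕ-fromℕ< i<1+p)))))) ,
  (λ l → ℕ.≤-<-trans (ℕ.≤-reflexive (Fin.toℕ-inject≤ (punchIn i′ l) 1+p≤k)) (Fin.toℕ<n (punchIn i′ l)))
  where i′ = fromℕ< i<1+p

-- A maximum clique of a component and its nonneighbours.

record MaximumClique {n : ℕ} (G : Graph n) (S : Pred (Fin n) 0ℓ) (k : ℕ) : Set where
  field
    S?        : U.Decidable S
    connected : ∀ {x y} → S x → S y → Star (Adj G) x y
    -- The clique is enumerated, so that N(x) becomes a set of indices and its elements and pairs
    -- can serve as colours.
    v         : Fin k → Fin n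
    v∈S       : ∀ i → S (v i)
    v-clique  : ∀ {i j} → i ≢ j → Adj G (v i) (v j)
    maximum   : (u : Fin (ℕ.suc k) → Fin n) → (∀ i → S (u i)) →
                ¬ (∀ {i j} → i ≢ j → Adj G (u i) (u j))
    k≢2       : k ≢ 2

module MaximumCliqueProperties {n : ℕ} {G : Graph n}
  (noButterfly : ¬ InducedIn butterfly G) (noHammer : ¬ InducedIn hammer G)
  {S : Pred (Fin n) 0ℓ} {k : ℕ} (C : MaximumClique G S k)
  where

  open MaximumClique C

  infix 4 _~_ _≁_
  _~_ _≁_ : Fin n → Fin n → Set
  x ~ y = Adj G x y
  x ≁ y = ¬ Adj G x y

  _~?_ : ∀ x y → Dec (x ~ y)
  _~?_ = _Adj?_ G

  ~-sym : ∀ {x y} → x ~ y → y ~ x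
  ~-sym = Adj-sym G

  ≁-sym : ∀ {x y} → x ≁ y → y ≁ x
  ≁-sym x≁y = x≁y ∘ ~-sym

  unextendable : ∀ {x} → S x → (u : Fin k → Fin n) → (∀ i → S (u i)) →
                 (∀ {i j} → i ≢ j → u i ~ u j) → ¬ (∀ i → x ~ u i)
  unextendable {x} x∈S u u∈S u-clique x~u =
    maximum w (λ { zero → x∈S ; (suc i) → u∈S i }) w-clique
    where
    w : Fin (ℕ.suc k) → Fin n
    w zero = x
    w (suc i) = u i
    w-clique : ∀ {i j} → i ≢ j → w i ~ w j
    w-clique {zero} {zero} i≢j = contradiction refl i≢j
    w-clique {zero} {suc j} _ = x~u j
    w-clique {suc i} {zero} _ = ~-sym (x~u i)
    w-clique {suc i} {suc j} i≢j = u-clique (i≢j ∘ cong suc)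

  ∃-nonneighbour : ∀ {x} → S x → ∃[ i ] x ≁ v i
  ∃-nonneighbour {x} x∈S =
    ¬∀⟶∃¬ k _ (λ i → x ~? v i) (unextendable x∈S v v∈S v-clique)

  v≁⇒≡ : ∀ {i j} → v i ≁ v j → i ≡ j
  v≁⇒≡ {i} {j} ≁ = decidable-stable (i ≟ j) (≁ ∘ v-clique)

  -- If x has no neighbour in the clique, walk towards the clique: the next
  -- vertex z again misses two clique vertices or closes a triangle with two.
  ≤1-common-nonneighbour : ∀ {x y i j} → S x → x ~ y → i ≢ j →
    x ≁ v i → x ≁ v j → y ≁ v i → y ≁ v j → ⊥
  ≤1-common-nonneighbour {i = i} x∈S = walk (connected x∈S (v∈S i))
    where
    walk : ∀ {a x y i j} → Star (Adj G) x (v a) → x ~ y → i ≢ j →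
           x ≁ v i → x ≁ v j → y ≁ v i → y ≁ v j → ⊥
    -- Here x is `v a`, which misses only itself in the clique, so i = a = j.
    walk ε _ i≢j xi xj _ _ = i≢j (trans (sym (v≁⇒≡ xi)) (v≁⇒≡ xj))
    walk {x = x} {y} {i} {j} (_◅_ {j = z} x~z path) x~y i≢j xi xj yi yj
      with any? (λ l → x ~? v l)
    ... | yes (l , x~l) =
      noPendantPath G noButterfly noHammer (v-clique i≢j)
        (v-clique (λ { refl → xi x~l })) (v-clique (λ { refl → xj x~l }))
        (~-sym x~l) x~y (≁-sym xi) (≁-sym xj) (≁-sym yi) (≁-sym yj)
    ... | no isolated with two-alike k≢2 (λ l → z ~? v l) i≢j
    -- The edge zx replaces xy: x misses the whole clique, so `v a` and `v b` are missed by both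
    -- ends.
    ...   | inj₂ (a , b , a≢b , za , zb) =
      walk path (~-sym x~z) a≢b za zb (isolated ∘ (a ,_)) (isolated ∘ (b ,_))
    -- Now z closes a triangle with `v a` and `v b`. If y misses the clique, the pendant path is z,
    -- x, y; otherwise it leaves the clique through y and continues to x.
    ...   | inj₁ (a , b , a≢b , za , zb) with any? (λ l → y ~? v l)
    ...     | no isolated′ =
      noPendantPath G noButterfly noHammer (v-clique a≢b) (~-sym za) (~-sym zb)
        (~-sym x~z) x~y (isolated ∘ (a ,_) ∘ ~-sym) (isolated ∘ (b ,_) ∘ ~-sym)
        (isolated′ ∘ (a ,_) ∘ ~-sym) (isolated′ ∘ (b ,_) ∘ ~-sym)
    ...     | yes (l , y~l) =
      noPendantPath G noButterfly noHammer (v-clique i≢j)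
        (v-clique (λ { refl → yi y~l })) (v-clique (λ { refl → yj y~l }))
        (~-sym y~l) (~-sym x~y) (≁-sym yi) (≁-sym yj) (≁-sym xi) (≁-sym xj)

  -- For x in `S`, where N(x) is nonempty, this means N(x) = {i}: x can replace `v i` in the clique.
  -- The vertex `v i` is itself in this class.
  Private : Fin n → Fin k → Set
  Private x i = ∀ j → x ≁ v j → j ≡ i

  private? : ∀ x i → Dec (Private x i)
  private? x i = all? λ j → ¬? (x ~? v j) →-dec (j ≟ i)

  private-or-other : ∀ x i → Private x i ⊎ ∃[ j ] j ≢ i × x ≁ v j
  private-or-other x i with any? (λ j → ¬? (j ≟ i) ×-dec ¬? (x ~? v j))
  ... | yes other = inj₂ other
  ... | no none = inj₁ λ j xj → decidable-stable (j ≟ i) λ j≢i → none (j , j≢i , xj)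

  private-neighbour : ∀ {x i j} → Private x i → j ≢ i → x ~ v j
  private-neighbour {x} {j = j} priv j≢i = decidable-stable (x ~? v j) (j≢i ∘ priv j)

  private-nonneighbour : ∀ {x i} → S x → Private x i → x ≁ v i
  private-nonneighbour {x} x∈S priv =
    let j , xj = ∃-nonneighbour x∈S in subst (λ i → x ≁ v i) (priv j xj) xj

  -- Replacing `v i` by y leaves a clique of size k, which an adjacent x would extend.
  private-independent : ∀ {x y i} → S x → S y → Private x i → Private y i → x ≁ y
  private-independent {x} {y} {i} x∈S y∈S px py x~y =
    unextendable x∈S u u∈S u-clique x~u
    where
    u : Fin k → Fin n
    u j = case j ≟ i of λ { (yes _) → y ; (no _) → v j }
    u∈S : ∀ j → S (u j)
    u∈S j with j ≟ i
    ... | yes _ = y∈S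
    ... | no _ = v∈S j
    x~u : ∀ j → x ~ u j
    x~u j with j ≟ i
    ... | yes _ = x~y
    ... | no j≢i = private-neighbour px j≢i
    u-clique : ∀ {j l} → j ≢ l → u j ~ u l
    u-clique {j} {l} j≢l with j ≟ i | l ≟ i
    ... | yes refl | yes refl = contradiction refl j≢l
    ... | yes refl | no l≢i = private-neighbour py l≢i
    ... | no j≢i | yes refl = ~-sym (private-neighbour py j≢i)
    ... | no _ | no _ = v-clique j≢l

  module _ {p : ℕ} (noJoin : ¬ InducedIn (join P₄ (K p)) G) where

    -- Suppose x also misses `v j`. If y misses it too, the edge xy has two common nonneighbours;
    -- otherwise `v i`, `v j`, y, x is an induced path, complete to the p clique vertices picked by
    -- h.
    private-or-P₄ : ∀ {x y i} → S x → x ≁ v i → y ≁ v i →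
      (h : Fin p → Fin k) → (∀ {l r} → l ≢ r → h l ≢ h r) →
      (∀ l → x ~ v (h l)) → (∀ l → y ~ v (h l)) → x ~ y → Private x i
    private-or-P₄ {x} {y} {i} x∈S xi yi h h-inj xh yh x~y with private-or-other x i
    ... | inj₁ priv = priv
    ... | inj₂ (j , j≢i , xj) with y ~? v j
    ...   | no yj = ⊥-elim (≤1-common-nonneighbour x∈S x~y j≢i xj xi yj yi)
    ...   | yes y~j = ⊥-elim (noP₄InCommonNbhd G noJoin
              (v-clique (≢-sym j≢i)) (~-sym y~j) (~-sym x~y)
              (≁-sym yi) (≁-sym xi) (≁-sym xj)
              (v ∘ h) (v-clique ∘ h-inj)
              (λ l → v-clique λ { refl → xi (xh l) })
              (λ l → v-clique λ { refl → xj (xh l) }) yh xh)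

    -- On an edge xy the previous lemma applies in both directions, making both ends private to i.
    common-neighbours⇒≁ : ∀ {x y i} → S x → S y → x ≁ v i → y ≁ v i →
      (h : Fin p → Fin k) → (∀ {l r} → l ≢ r → h l ≢ h r) →
      (∀ l → x ~ v (h l)) → (∀ l → y ~ v (h l)) → x ≁ y
    common-neighbours⇒≁ x∈S y∈S xi yi h h-inj xh yh x~y =
      private-independent x∈S y∈S
        (private-or-P₄ x∈S xi yi h h-inj xh yh x~y)
        (private-or-P₄ y∈S yi xi h h-inj yh xh (~-sym x~y)) x~y

    -- A nonadjacent pair x, y would give the path x , v j , v i , y.
    privates-adjacent : 2 ℕ.+ p ℕ.≤ k → ∀ {x y i j} → S x → S y → i ≢ j →
                        Private x i → Private y j → x ~ y
    privates-adjacent 2+p≤k {x} {y} {i} {j} x∈S y∈S i≢j px py =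
      let h , h-inj , h≢i , h≢j = avoid-two 2+p≤k i≢j in
      decidable-stable (x ~? y) λ x≁y →
        noP₄InCommonNbhd G noJoin
          (private-neighbour px (≢-sym i≢j)) (v-clique (≢-sym i≢j))
          (~-sym (private-neighbour py i≢j))
          (private-nonneighbour x∈S px) x≁y (≁-sym (private-nonneighbour y∈S py))
          (v ∘ h) (v-clique ∘ h-inj)
          (λ l → private-neighbour px (h≢i l))
          (λ l → v-clique (≢-sym (h≢j l))) (λ l → v-clique (≢-sym (h≢i l)))
          (λ l → private-neighbour py (h≢j l))

    v-private : ∀ i → Private (v i) i
    v-private i j vi≁vj = sym (v≁⇒≡ vi≁vj)

    -- If x had a neighbour in every private class, those neighbours would be pairwise adjacent and
    -- form with x a clique of size k + 1.
    missed-private-class : 2 ℕ.+ p ℕ.≤ k → ∀ {x} → S x →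
      ∃[ i ] x ≁ v i × (∀ y → S y → Private y i → x ≁ y)
    missed-private-class 2+p≤k {x} x∈S = i ,
      (λ x~vi → miss (v i , v∈S i , v-private i , x~vi)) ,
      (λ y y∈S py x~y → miss (y , y∈S , py , x~y))
      where
      Met : Fin k → Set
      Met i = ∃[ y ] S y × Private y i × x ~ y

      not-all-met : ¬ (∀ i → Met i)
      not-all-met met = unextendable x∈S (proj₁ ∘ met) (proj₁ ∘ proj₂ ∘ met)
        (λ {i} {j} i≢j → privates-adjacent 2+p≤k
          (proj₁ (proj₂ (met i))) (proj₁ (proj₂ (met j))) i≢j
          (proj₁ (proj₂ (proj₂ (met i)))) (proj₁ (proj₂ (proj₂ (met j)))))
        (proj₂ ∘ proj₂ ∘ proj₂ ∘ met)

      missed : ∃[ i ] ¬ Met i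
      missed = ¬∀⟶∃¬ k Met
        (λ i → any? λ y → S? y ×-dec private? y i ×-dec (x ~? y)) not-all-met

      i = proj₁ missed
      miss = proj₂ missed

  -- Codes live in `ℕ` because the two colourings below bound them differently.
  PairColour : Fin n → ℕ → Set
  PairColour x c = ∃₂ λ i j → i < j × x ≁ v i × x ≁ v j × c ≡ tri (toℕ j) ℕ.+ toℕ i

  pairColour-proper : ∀ {x y c} → S x → PairColour x c → PairColour y c → x ≁ y
  pairColour-proper {x} {y} x∈S (i , j , i<j , xi , xj , eq) (i′ , j′ , i′<j′ , yi , yj , eq′) x~y
    with i≡i′ , j≡j′ ← tri-+-injective i<j i′<j′ (trans (sym eq) eq′) =
    ≤1-common-nonneighbour x∈S x~y (Fin.<⇒≢ i<j) xi xj
      (subst (λ i → y ≁ v i) (sym (Fin.toℕ-injective i≡i′)) yi)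
      (subst (λ j → y ≁ v j) (sym (Fin.toℕ-injective j≡j′)) yj)

  pairColour : ∀ {M x i j} → i < j → x ≁ v i → x ≁ v j →
               tri (toℕ j) ℕ.+ toℕ i ℕ.< M → ∃[ c ] PairColour x (toℕ {M} c)
  pairColour i<j xi xj code<M =
    fromℕ< code<M , _ , _ , i<j , xi , xj , Fin.toℕ-fromℕ< code<M

-- Colourings of a vertex set.

ColouringOn : ∀ {n} → Graph n → Pred (Fin n) 0ℓ → Set → Set
ColouringOn G S A = Σ (∀ x → S x → A) λ c →
  ∀ {x y} (x∈S : S x) (y∈S : S y) → Adj G x y → c x x∈S ≢ c y y∈S

-- Properness is required of all permitted colours, so nothing about the particular choice has to be
-- remembered.
colourBy : ∀ {n} {G : Graph n} {S : Pred (Fin n) 0ℓ} {A : Set} (May : Fin n → A → Set) →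
           (∀ {x} → S x → ∃ (May x)) →
           (∀ {x y a} → S x → S y → May x a → May y a → ¬ Adj G x y) →
           ColouringOn G S A
colourBy May choose proper =
  (λ x x∈S → proj₁ (choose x∈S)) ,
  λ {x} {y} x∈S y∈S xy eq →
    proper x∈S y∈S (subst (May x) eq (proj₂ (choose x∈S))) (proj₂ (choose y∈S)) xy

recolour : ∀ {n} {G : Graph n} {S : Pred (Fin n) 0ℓ} {A B : Set} (f : A → B) →
           (∀ a b → f a ≡ f b → a ≡ b) → ColouringOn G S A → ColouringOn G S B
recolour f f-inj (c , proper) =
  (λ x x∈S → f (c x x∈S)) , λ x∈S y∈S xy → proper x∈S y∈S xy ∘ f-inj _ _

join-injective : ∀ m n (s t : Fin m ⊎ Fin n) →
                 Data.Fin.Base.join m n s ≡ Data.Fin.Base.join m n t → s ≡ t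
join-injective m n s t eq =
  trans (sym (Fin.splitAt-join m n s)) (trans (cong (splitAt m) eq) (Fin.splitAt-join m n t))

-- The two colourings of a component.

module _ {n : ℕ} {G : Graph n}
  (noButterfly : ¬ InducedIn butterfly G) (noHammer : ¬ InducedIn hammer G)
  {S : Pred (Fin n) 0ℓ}
  where

  colour-small : ∀ {k} → MaximumClique G S k →
                 ColouringOn G S (Fin (k ℕ.+ tri k))
  colour-small {k} C = recolour {G = G} (Data.Fin.Base.join k (tri k)) (join-injective k (tri k))
    (colourBy {G = G} May choose proper)
    where
    open MaximumClique C
    open MaximumCliqueProperties noButterfly noHammer C

    May : Fin n → Fin k ⊎ Fin (tri k) → Set
    May x (inj₁ i) = Private x i
    May x (inj₂ c) = PairColour x (toℕ c)

    choose : ∀ {x} → S x → ∃ (May x)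
    choose {x} x∈S with i , xi ← ∃-nonneighbour x∈S with private-or-other x i
    ... | inj₁ px = inj₁ i , px
    ... | inj₂ (j , j≢i , xj) with <-cmp i j
    ...   | tri≈ _ i≡j _ = contradiction (sym i≡j) j≢i
    ...   | tri< i<j _ _ =
      let c , pc = pairColour i<j xi xj (tri-+-< i<j (Fin.toℕ<n j)) in inj₂ c , pc
    ...   | tri> _ _ j<i =
      let c , pc = pairColour j<i xj xi (tri-+-< j<i (Fin.toℕ<n i)) in inj₂ c , pc

    proper : ∀ {x y a} → S x → S y → May x a → May y a → x ≁ y
    proper {a = inj₁ i} x∈S y∈S px py = private-independent x∈S y∈S px py
    proper {a = inj₂ c} x∈S _ pc qc = pairColour-proper x∈S pc qc

  -- Here p = q + 1. A vertex receives the colour z of the tail only if it is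
  -- adjacent to the whole head and to the cyclic predecessor of z, so that two
  -- such vertices have p common neighbours in the clique; a vertex missing the
  -- whole tail shares two nonneighbours with any other user of its colour,
  -- unless that one is private to z and then nonadjacent by the choice of z.
  colour-large : ∀ {q m} → 2 ℕ.≤ m → ¬ InducedIn (join P₄ (K (ℕ.suc q))) G →
                 MaximumClique G S (q ℕ.+ ℕ.suc m) →
                 ColouringOn G S (Fin ((q ℕ.+ ℕ.suc m) ℕ.+ (tri (ℕ.suc q) ℕ.+ q)))
  colour-large {q} {m} 2≤m noJoin C =
    recolour {G = G} enc enc-injective (colourBy {G = G} May choose proper)
    where
    open MaximumClique C
    open MaximumCliqueProperties noButterfly noHammer C

    k = q ℕ.+ ℕ.suc m
    -- This is C(p+1,2) - 1, the code of the pair {q, q+1}. Smaller codes belong exactly to the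
    -- other pairs among the first p + 1 = q + 2 indices, whose smaller entry is below q.
    M = tri (ℕ.suc q) ℕ.+ q

    2+q≤k : 2 ℕ.+ q ℕ.≤ k
    2+q≤k = ℕ.≤-trans (ℕ.≤-reflexive (ℕ.+-comm 2 q)) (ℕ.+-monoʳ-≤ q (ℕ.≤-trans 2≤m (ℕ.n≤1+n m)))

    3+q≤k : 3 ℕ.+ q ℕ.≤ k
    3+q≤k = ℕ.≤-trans (ℕ.≤-reflexive (ℕ.+-comm 3 q)) (ℕ.+-monoʳ-≤ q (s≤s 2≤m))

    Colour = (Fin q ⊎ Fin (ℕ.suc m)) ⊎ Fin M

    enc : Colour → Fin (k ℕ.+ M)
    enc = Data.Fin.Base.join k M ∘ map₁ (Data.Fin.Base.join q (ℕ.suc m))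

    enc-injective : ∀ a b → enc a ≡ enc b → a ≡ b
    enc-injective (inj₁ s) (inj₁ t) eq =
      cong inj₁ (join-injective q _ s t (inj₁-injective (join-injective k M (inj₁ _) (inj₁ _) eq)))
    enc-injective (inj₁ s) (inj₂ d) eq with () ← join-injective k M (inj₁ _) (inj₂ d) eq
    enc-injective (inj₂ c) (inj₁ t) eq with () ← join-injective k M (inj₂ c) (inj₁ _) eq
    enc-injective (inj₂ c) (inj₂ d) eq = cong inj₂ (inj₂-injective (join-injective k M (inj₂ c) (inj₂ d) eq))

    head : Fin q → Fin k
    head l = l ↑ˡ ℕ.suc m
    tail : Fin (ℕ.suc m) → Fin k
    tail z = q ↑ʳ z

    toℕ-head : ∀ l → toℕ (head l) ℕ.< q
    toℕ-head l = ℕ.≤-<-trans (ℕ.≤-reflexive (Fin.toℕ-↑ˡ l (ℕ.suc m))) (Fin.toℕ<n l)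

    head≢tail : ∀ {l z} → head l ≢ tail z
    head≢tail {l} {z} eq with
      () ← trans (sym (Fin.splitAt-↑ˡ q l (ℕ.suc m)))
             (trans (cong (splitAt q) eq) (Fin.splitAt-↑ʳ q (ℕ.suc m) z))

    head-or-tail : ∀ i → (∃[ l ] head l ≡ i) ⊎ (∃[ z ] tail z ≡ i)
    head-or-tail i with splitAt q i in eq
    ... | inj₁ l = inj₁ (l , Fin.splitAt⁻¹-↑ˡ eq)
    ... | inj₂ z = inj₂ (z , Fin.splitAt⁻¹-↑ʳ eq)

    TailColour : Fin n → Fin (ℕ.suc m) → Set
    TailColour x z =
      x ~ v (tail (prev z)) ⊎
      (∀ z′ → x ≁ v (tail z′)) × (∀ y → S y → Private y (tail z) → x ≁ y)

    May : Fin n → Colour → Set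
    -- Two users of a head colour share as neighbours the p vertices left among the first p + 1 when
    -- `head l` is dropped.
    May x (inj₁ (inj₁ l)) =
      x ≁ v (head l) × (∀ t → toℕ t ℕ.< 2 ℕ.+ q → t ≢ head l → x ~ v t)
    May x (inj₁ (inj₂ z)) =
      x ≁ v (tail z) × (∀ l → x ~ v (head l)) × TailColour x z
    May x (inj₂ c) = PairColour x (toℕ c)

    code< : ∀ {i j} → i ℕ.< q → j ℕ.< 2 ℕ.+ q → tri j ℕ.+ i ℕ.< M
    code< i<q (s≤s j≤) = ℕ.+-mono-≤-< (tri-mono j≤) i<q

    pair-choice : ∀ {x l t} → x ≁ v (head l) → toℕ t ℕ.< 2 ℕ.+ q → t ≢ head l → x ≁ v t →
                  ∃ (May x)
    pair-choice {x} {l} {t} xl t<T t≢l xt with <-cmp (head l) t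
    ... | tri≈ _ l≡t _ = contradiction (sym l≡t) t≢l
    ... | tri< l<t _ _ =
      let c , pc = pairColour l<t xl xt (code< (toℕ-head l) t<T) in inj₂ c , pc
    ... | tri> _ _ t<l =
      let c , pc = pairColour t<l xt xl (code< (ℕ.<-trans t<l (toℕ-head l))
                     (ℕ.<-trans (toℕ-head l) (ℕ.m≤n+m _ 1)))
      in inj₂ c , pc

    choose : ∀ {x} → S x → ∃ (May x)
    choose {x} x∈S with any? (λ l → ¬? (x ~? v (head l)))
    choose {x} x∈S | yes (l , xl)
      with any? (λ t → (toℕ t ℕ.<? 2 ℕ.+ q) ×-dec ¬? (t ≟ head l) ×-dec ¬? (x ~? v t))
    ... | yes (t , t<T , t≢l , xt) = pair-choice xl t<T t≢l xt
    ... | no none = inj₁ (inj₁ l) , xl , λ t t<T t≢l →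
            decidable-stable (x ~? v t) λ xt → none (t , t<T , t≢l , xt)
    choose {x} x∈S | no none =
      let x~head = λ l → decidable-stable (x ~? v (head l)) (none ∘ (l ,_))
          nonnbr-in-tail : ∀ i → x ≁ v i → ∃[ z ] tail z ≡ i
          nonnbr-in-tail i xi = [ (λ { (l , refl) → contradiction (x~head l) xi }) , id ]′ (head-or-tail i)
          i , xi = ∃-nonneighbour x∈S
          z₀ , z₀≡i = nonnbr-in-tail i xi
      -- N(x) is now a nonempty subset of the tail: either it is the whole tail, or some
      -- nonneighbour has a neighbour of x as its cyclic predecessor.
      in case all-or-boundary (λ z → ¬? (x ~? v (tail z)))
                (z₀ , subst (λ i → x ≁ v i) (sym z₀≡i) xi) of λ
        { (inj₂ (z , xz , ¬xp)) → inj₁ (inj₂ z) , xz , x~head ,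
            inj₁ (decidable-stable (x ~? v (tail (prev z))) ¬xp)
        ; (inj₁ all) → case missed-private-class noJoin 3+q≤k x∈S of λ
            { (j , xj , miss) → case nonnbr-in-tail j xj of λ
                { (z , refl) → inj₁ (inj₂ z) , xj , x~head , inj₂ (all , miss) } } }

    full-proper : ∀ {x y z} → S x → S y → x ≁ v (tail z) → y ≁ v (tail z) →
      (∀ z′ → x ≁ v (tail z′)) → (∀ y → S y → Private y (tail z) → x ≁ y) →
      (∀ l → y ~ v (head l)) → x ≁ y
    full-proper {x} {y} {z} x∈S y∈S xz yz x≁tail miss y~head x~y
      with private-or-other y (tail z)
    ... | inj₁ py = miss y y∈S py x~y
    ... | inj₂ (j , j≢z , yj) with head-or-tail j
    ...   | inj₁ (l , refl) = yj (y~head l)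
    ...   | inj₂ (z′ , refl) =
      ≤1-common-nonneighbour x∈S x~y j≢z (x≁tail z′) xz yj yz

    proper : ∀ {x y a} → S x → S y → May x a → May y a → x ≁ y
    proper {a = inj₁ (inj₁ l)} x∈S y∈S (xl , x~T) (yl , y~T) =
      let h , h-inj , h≢l , h<T = avoid-one 2+q≤k (ℕ.<-trans (toℕ-head l) (ℕ.m≤n+m _ 1)) in
      common-neighbours⇒≁ noJoin x∈S y∈S xl yl h h-inj
        (λ r → x~T (h r) (h<T r) (h≢l r)) (λ r → y~T (h r) (h<T r) (h≢l r))
    proper {x} {y} {inj₁ (inj₂ z)} x∈S y∈S (xz , x~head , inj₁ xp) (yz , y~head , inj₁ yp) =
      common-neighbours⇒≁ noJoin x∈S y∈S xz yz h h-inj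
        (λ { zero → xp ; (suc l) → x~head l }) (λ { zero → yp ; (suc l) → y~head l })
      where
      h : Fin (ℕ.suc q) → Fin k
      h zero = tail (prev z)
      h (suc l) = head l
      h-inj : ∀ {l r} → l ≢ r → h l ≢ h r
      h-inj {zero} {zero} l≢r _ = l≢r refl
      h-inj {zero} {suc r} _ eq = head≢tail (sym eq)
      h-inj {suc l} {zero} _ eq = head≢tail eq
      h-inj {suc l} {suc r} l≢r eq = l≢r (cong suc (Fin.↑ˡ-injective (ℕ.suc m) l r eq))
    proper {a = inj₁ (inj₂ z)} x∈S y∈S (xz , _ , inj₂ (x≁tail , miss)) (yz , y~head , _) =
      full-proper x∈S y∈S xz yz x≁tail miss y~head
    proper {a = inj₁ (inj₂ z)} x∈S y∈S (xz , x~head , _) (yz , _ , inj₂ (y≁tail , miss)) =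
      full-proper y∈S x∈S yz xz y≁tail miss x~head ∘ ~-sym
    proper {a = inj₂ c} x∈S _ pc qc = pairColour-proper x∈S pc qc

-- Connected components.

record Components {n : ℕ} (G : Graph n) : Set where
  field
    rep      : Fin n → Fin n
    rep≡⇒Star : ∀ {x y} → rep x ≡ rep y → Star (Adj G) x y
    Adj⇒rep≡ : ∀ {x y} → Adj G x y → rep x ≡ rep y

  Star⇒rep≡ : ∀ {x y} → Star (Adj G) x y → rep x ≡ rep y
  Star⇒rep≡ ε = refl
  Star⇒rep≡ (xy ◅ path) = trans (Adj⇒rep≡ xy) (Star⇒rep≡ path)

-- Union-find over all ordered pairs: each edge ab sends the class of b to the representative of a.
-- This makes membership in a component decidable.
components : ∀ {n} (G : Graph n) → Components G
components {n} G =
  let rep , sound , complete = merge (cartesianProduct (allFin n) (allFin n)) in record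
  { rep = rep ; rep≡⇒Star = sound
  ; Adj⇒rep≡ = complete (∈-cartesianProduct⁺ (∈-allFin _) (∈-allFin _)) }
  where
  merge : (es : List (Fin n × Fin n)) → Σ (Fin n → Fin n) λ rep →
          (∀ {x y} → rep x ≡ rep y → Star (Adj G) x y) ×
          (∀ {x y} → (x , y) ∈ₗ es → Adj G x y → rep x ≡ rep y)
  merge [] = id , (λ { refl → ε }) , λ ()
  merge ((a , b) ∷ es) with merge es | _Adj?_ G a b
  ... | rep , sound , complete | no ¬ab =
    rep , sound , λ { (here refl) ab → contradiction ab ¬ab ; (there e) → complete e }
  ... | rep , sound , complete | yes ab =
    redirect ∘ rep , sound′ , λ { (here refl) _ → merged ; (there e) → cong redirect ∘ complete e }
    where
    redirect : Fin n → Fin n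
    redirect r = case r ≟ rep b of λ { (yes _) → rep a ; (no _) → r }

    merged : redirect (rep a) ≡ redirect (rep b)
    merged with rep a ≟ rep b | rep b ≟ rep b
    ... | _ | no b≢b = contradiction refl b≢b
    ... | yes _ | yes _ = refl
    ... | no _ | yes _ = refl

    sound′ : ∀ {x y} → redirect (rep x) ≡ redirect (rep y) → Star (Adj G) x y
    sound′ {x} {y} eq with rep x ≟ rep b | rep y ≟ rep b
    ... | yes xb | yes yb = sound (trans xb (sym yb))
    -- Only x was redirected, so y lies in the old class of a and the walk crosses from b to a.
    ... | yes xb | no _ = sound xb ◅◅ Adj-sym G ab ◅ sound eq
    ... | no _ | yes yb = sound eq ◅◅ ab ◅ sound (sym yb)
    ... | no _ | no _ = sound eq

-- Subsets, enumerations and clique numbers.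

module _ {n : ℕ} {P : Pred (Fin n) 0ℓ} (P? : U.Decidable P) where

  subsetOf : Subset n
  subsetOf = Vec.tabulate (does ∘ P?)

  ∈-subsetOf⁺ : ∀ {x} → P x → x ∈ subsetOf
  ∈-subsetOf⁺ {x} Px = lookup⇒[]= x _ (trans (lookup∘tabulate _ x) (dec-true (P? x) Px))

  ∈-subsetOf⁻ : ∀ {x} → x ∈ subsetOf → P x
  ∈-subsetOf⁻ {x} x∈ with P? x | trans (sym (lookup∘tabulate (does ∘ P?) x)) ([]=⇒lookup x∈)
  ... | yes Px | _ = Px
  ... | no _ | ()

members : ∀ {n} (Q : Subset n) → Σ (Fin ∣ Q ∣ → Fin n) λ u →
          (∀ i → u i ∈ Q) × (∀ {i j} → i ≢ j → u i ≢ u j)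
members Vec.[] = (λ ()) , (λ ()) , λ {i} → contradiction i λ ()
members (outside Vec.∷ Q) =
  let u , u∈Q , u-inj = members Q in
  suc ∘ u , (λ i → Vec.there (u∈Q i)) , λ i≢j → u-inj i≢j ∘ Fin.suc-injective
members {ℕ.suc n} (inside Vec.∷ Q) = w , w∈ , λ {i} {j} → w-inj i j
  where
  u = proj₁ (members Q)
  w : Fin (ℕ.suc ∣ Q ∣) → Fin (ℕ.suc n)
  w zero = zero
  w (suc i) = suc (u i)
  w∈ : ∀ i → w i ∈ (inside Vec.∷ Q)
  w∈ zero = Vec.here
  w∈ (suc i) = Vec.there (proj₁ (proj₂ (members Q)) i)
  w-inj : ∀ i j → i ≢ j → w i ≢ w j
  w-inj zero zero i≢j _ = i≢j refl
  w-inj (suc i) (suc j) i≢j eq =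
    proj₂ (proj₂ (members Q)) (i≢j ∘ cong suc) (Fin.suc-injective eq)

injection⇒≤∣∣ : ∀ {n k} (Q : Subset n) (u : Fin k → Fin n) →
                (∀ {i j} → i ≢ j → u i ≢ u j) → (∀ i → u i ∈ Q) → k ≤ ∣ Q ∣
injection⇒≤∣∣ {k = ℕ.zero} Q u u-inj u∈Q = z≤n
injection⇒≤∣∣ {k = ℕ.suc k} Q u u-inj u∈Q =
  ℕ.≤-<-trans
    (injection⇒≤∣∣ (Q - u zero) (u ∘ suc) (λ i≢j → u-inj (i≢j ∘ Fin.suc-injective))
      (λ i → x∈p∧x≢y⇒x∈p-y (u∈Q (suc i)) (u-inj λ ())))
    (x∈p⇒∣p-x∣<∣p∣ (u∈Q zero))

module _ {n : ℕ} (G : Graph n) where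

  isClique? : ∀ Q → Dec (IsClique G Q)
  isClique? Q = map′ (λ f {x} {y} → f x y) (λ f x y → f {x} {y})
    (all? λ x → all? λ y →
      (x ∈? Q) →-dec (y ∈? Q) →-dec ¬? (x ≟ y) →-dec _Adj?_ G x y)

  -- The bound m is lowered until a clique of that size exists; at zero the empty set is one.
  ∃-cliqueNumberOn : ∀ S m → (∀ Q → Q ⊆ S → IsClique G Q → ∣ Q ∣ ≤ m) →
                     ∃[ k ] k ≤ m × IsCliqueNumberOn G S k
  ∃-cliqueNumberOn S m bound
    with anySubset? (λ Q → (Q ⊆? S) ×-dec isClique? Q ×-dec (∣ Q ∣ ℕ.≟ m))
  ... | yes (Q , Q⊆S , Q-clique , ∣Q∣≡m) =
    m , ℕ.≤-refl , (Q , Q⊆S , Q-clique , ∣Q∣≡m) , bound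
  ∃-cliqueNumberOn S ℕ.zero bound | no none =
    ⊥-elim (none (∅ , ⊥-elim ∘ ∉⊥ , (λ x∈∅ → contradiction x∈∅ ∉⊥) , ∣⊥∣≡0 n))
  ∃-cliqueNumberOn S (ℕ.suc m) bound | no none =
    let k , k≤m , isω = ∃-cliqueNumberOn S m λ Q Q⊆S Q-clique →
          ℕ.≤-pred (ℕ.≤∧≢⇒< (bound Q Q⊆S Q-clique) λ eq → none (Q , Q⊆S , Q-clique , eq))
    in k , ℕ.m≤n⇒m≤1+n k≤m , isω

  cliqueNumberOn⇒enumeration : ∀ {S k} → IsCliqueNumberOn G S k →
    Σ (Fin k → Fin n) λ v → (∀ i → v i ∈ S) × (∀ {i j} → i ≢ j → Adj G (v i) (v j))
  cliqueNumberOn⇒enumeration ((Q , Q⊆S , Q-clique , refl) , _) =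
    let v , v∈Q , v-inj = members Q in
    v , (λ i → Q⊆S (v∈Q i)) , λ i≢j → Q-clique (v∈Q _) (v∈Q _) (v-inj i≢j)

  cliqueNumberOn⇒no-larger : ∀ {S k} → IsCliqueNumberOn G S k →
    (u : Fin (ℕ.suc k) → Fin n) → (∀ i → u i ∈ S) → ¬ (∀ {i j} → i ≢ j → Adj G (u i) (u j))
  cliqueNumberOn⇒no-larger {S} {k} (_ , bound) u u∈S u-clique =
    ℕ.<⇒≱ (injection⇒≤∣∣ image u u-inj (λ i → ∈-subsetOf⁺ hit? (i , refl)))
      (bound image image⊆S image-clique)
    where
    hit? : U.Decidable λ x → ∃[ i ] u i ≡ x
    hit? x = any? λ i → u i ≟ x
    image = subsetOf hit?
    u-inj : ∀ {i j} → i ≢ j → u i ≢ u j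
    u-inj {i} {j} i≢j eq = Adj-irr G (u j) (subst (λ x → Adj G x (u j)) eq (u-clique i≢j))
    image⊆S : image ⊆ S
    image⊆S x∈ with i , refl ← ∈-subsetOf⁻ hit? x∈ = u∈S i
    image-clique : IsClique G image
    image-clique x∈ y∈ x≢y
      with i , refl ← ∈-subsetOf⁻ hit? x∈ | j , refl ← ∈-subsetOf⁻ hit? y∈ =
      u-clique (x≢y ∘ cong u)

  -- Reduction to single components.

  module _ (C : Components G) where
    open Components C

    component-maximumClique : (∀ C → IsComponent G C → ¬ IsCliqueNumberOn G C 2) →
      ∀ {ω} → IsCliqueNumber G ω → ∀ x →
      ∃[ k ] k ≤ ω × MaximumClique G (λ y → rep y ≡ rep x) k
    component-maximumClique noTwo {ω} (_ , bound) x =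
      let k , k≤ω , isω = ∃-cliqueNumberOn cell ω (λ Q _ → bound Q ⊆⊤)
          v , v∈ , v-clique = cliqueNumberOn⇒enumeration isω
      in k , k≤ω , record
        { S? = inCell?
        ; connected = λ y z → rep≡⇒Star (trans y (sym z))
        ; v = v ; v∈S = λ i → ∈-subsetOf⁻ inCell? (v∈ i) ; v-clique = v-clique
        ; maximum = λ u u∈S → cliqueNumberOn⇒no-larger isω u (λ i → ∈-subsetOf⁺ inCell? (u∈S i))
        ; k≢2 = λ k≡2 → noTwo cell cell-component
                             (subst (IsCliqueNumberOn G cell) k≡2 isω) }
      where
      inCell? : U.Decidable λ y → rep y ≡ rep x
      inCell? y = rep y ≟ rep x
      cell = subsetOf inCell?
      cell-component : IsComponent G cell
      cell-component = (x , ∈-subsetOf⁺ inCell? refl) , λ y∈ z → mk⇔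
        (λ z∈ → rep≡⇒Star (trans (∈-subsetOf⁻ inCell? y∈) (sym (∈-subsetOf⁻ inCell? z∈))))
        (λ path → ∈-subsetOf⁺ inCell?
          (trans (sym (Star⇒rep≡ path)) (∈-subsetOf⁻ inCell? y∈)))

    colour-componentwise : ∀ {K} → (∀ x → ColouringOn G (λ y → rep y ≡ rep x) (Fin K)) →
                           Colourable G K
    colour-componentwise {K} colour =
      (λ x → proj₁ (colourFibre (rep x)) x refl) ,
      λ xy → proper refl refl (Adj⇒rep≡ xy) xy
      where
      -- The colouring is chosen once per representative, so that adjacent vertices use the same
      -- one.
      colourFibre : ∀ r → ColouringOn G (λ y → rep y ≡ r) (Fin K)
      colourFibre r with any? (λ x → rep x ≟ r)
      ... | yes (x , refl) = colour x
      ... | no none = (λ x x∈ → contradiction (x , x∈) none) ,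
                      λ x∈ _ _ → contradiction (_ , x∈) none
      -- Two representatives r and s with an equality between them allow matching on `refl`, which
      -- is impossible for `rep x ≡ rep y` itself.
      proper : ∀ {x y r s} (x∈ : rep x ≡ r) (y∈ : rep y ≡ s) → r ≡ s → Adj G x y →
               proj₁ (colourFibre r) x x∈ ≢ proj₁ (colourFibre s) y y∈
      proper {r = r} x∈ y∈ refl = proj₂ (colourFibre r) x∈ y∈

-- Counting colours and the final bounds.

widen : ∀ {n} {G : Graph n} {S : Pred (Fin n) 0ℓ} {k l} → k ≤ l →
        ColouringOn G S (Fin k) → ColouringOn G S (Fin l)
widen {G = G} k≤l = recolour {G = G} (λ i → inject≤ i k≤l) (Fin.inject≤-injective k≤l k≤l)

tri-*-2 : ∀ p → tri (ℕ.suc p) * 2 ≡ p * (p + 1)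
tri-*-2 ℕ.zero = refl
tri-*-2 (ℕ.suc p) =
  trans (ℕ.*-distribʳ-+ 2 (tri (ℕ.suc p)) (ℕ.suc p))
    (trans (cong (_+ ℕ.suc p * 2) (tri-*-2 p)) (expand p))
  where
  expand : ∀ p → p * (p + 1) + ℕ.suc p * 2 ≡ ℕ.suc p * (ℕ.suc p + 1)
  expand = solve-∀

tri-closed-form : ∀ p → p * (p + 1) / 2 ≡ tri (ℕ.suc p)
tri-closed-form p = trans (cong (_/ 2) (sym (tri-*-2 p))) (m*n/n≡m (tri (ℕ.suc p)) 2)

module _ {n : ℕ} {G : Graph n}
  (noButterfly : ¬ InducedIn butterfly G) (noHammer : ¬ InducedIn hammer G)
  {S : Pred (Fin n) 0ℓ}
  where

  small-clique-colouring : ∀ {p k ω} → k ≤ ω → k ≤ ℕ.suc p → MaximumClique G S k →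
                           ColouringOn G S (Fin (ω + tri (ℕ.suc p)))
  small-clique-colouring k≤ω k≤1+p C =
    widen {G = G} (ℕ.+-mono-≤ k≤ω (tri-mono k≤1+p)) (colour-small noButterfly noHammer C)

  -- A component may have k ≤ p + 1 although ω ≥ p + 2. The small colouring then still fits: (p+1) +
  -- C(p+1,2) = (p+2) + (C(p+1,2) - 1).
  large-ω-colouring : ∀ {q k ω} → ¬ InducedIn (join P₄ (K (ℕ.suc q))) G →
                      k ≤ ω → 3 + q ≤ ω → MaximumClique G S k →
                      ColouringOn G S (Fin (ω + (tri (ℕ.suc q) + q)))
  large-ω-colouring {q} {k} {ω} noJoin k≤ω 3+q≤ω C with k ℕ.≤? 2 + q
  ... | yes k≤2+q = widen {G = G} fits (colour-small noButterfly noHammer C)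
    where
    open ℕ.≤-Reasoning
    fits : k + tri k ≤ ω + (tri (ℕ.suc q) + q)
    fits = begin
      k + tri k                                 ≤⟨ ℕ.+-mono-≤ k≤2+q (tri-mono k≤2+q) ⟩
      2 + q + (tri (ℕ.suc q) + ℕ.suc q)         ≡⟨ cong (2 + q +_) (ℕ.+-suc (tri (ℕ.suc q)) q) ⟩
      2 + q + ℕ.suc (tri (ℕ.suc q) + q)         ≡⟨ ℕ.+-suc (2 + q) _ ⟩
      3 + q + (tri (ℕ.suc q) + q)               ≤⟨ ℕ.+-monoˡ-≤ _ 3+q≤ω ⟩
      ω + (tri (ℕ.suc q) + q)                   ∎
  ... | no k≰2+q with o , refl ← ℕ.m≤n⇒∃[o]m+o≡n (ℕ.≰⇒> k≰2+q) =
    widen {G = G} (ℕ.+-monoˡ-≤ _ (subst (_≤ ω) (sym (shift q o)) k≤ω))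
      -- Here k = q + (3 + o), so the tail has 3 + o vertices and m = 2 + o.
      (colour-large noButterfly noHammer (s≤s (s≤s z≤n)) noJoin
        (subst (MaximumClique G S) (sym (shift q o)) C))
    where
    shift : ∀ q o → q + (3 + o) ≡ 3 + q + o
    shift = solve-∀

theorem3p9 : ∀ (p : ℕ) → 1 ≤ p →
    ∀ {n : ℕ} (G : Graph n) →
    Free ((5 , butterfly) ∷ (5 , hammer) ∷ (4 + p , join P₄ (K p)) ∷ []) G →
    (∀ C → IsComponent G C → ¬ IsCliqueNumberOn G C 2) →
    ∀ (ω χ : ℕ) → IsCliqueNumber G ω → IsChromaticNumber G χ →
    (1 ≤ ω × ω ≤ p + 1 → χ ≤ ω + p * (p + 1) / 2) ×
    (p + 2 ≤ ω → χ ≤ ω + p * (p + 1) / 2 ∸ 1)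
theorem3p9 (ℕ.suc q) _ {n} G (noButterfly ∷ noHammer ∷ noJoin ∷ _) noTwo ω χ isω (_ , χ-least) =
  (λ { (_ , ω≤p+1) → χ-least _ (colour-with (cong (ω +_) (sym (tri-closed-form p)))
        λ k≤ω → small-clique-colouring noButterfly noHammer k≤ω
          (ℕ.≤-trans k≤ω (ℕ.≤-trans ω≤p+1 (ℕ.≤-reflexive (ℕ.+-comm p 1))))) }) ,
  (λ p+2≤ω → χ-least _ (colour-with large-count
        λ k≤ω → large-ω-colouring noButterfly noHammer noJoin k≤ω
          (ℕ.≤-trans (ℕ.≤-reflexive (ℕ.+-comm 2 p)) p+2≤ω)))
  where
  p = ℕ.suc q
  C = components G
  open Components C

  colour-with : ∀ {A B} → B ≡ A →
    (∀ {k S} → k ≤ ω → MaximumClique G S k → ColouringOn G S (Fin B)) → Colourable G A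
  colour-with refl colour = colour-componentwise G C λ x →
    let k , k≤ω , M = component-maximumClique G C noTwo isω x in colour k≤ω M

  -- Since `tri (suc p)` is `tri p + suc q`, the subtraction removes this successor and never
  -- truncates.
  large-count : ω + (tri (ℕ.suc q) + q) ≡ ω + p * (p + 1) / 2 ∸ 1
  large-count = sym (trans (cong (λ t → ω + t ∸ 1) (tri-closed-form p))
    (cong (_∸ 1) (trans (cong (ω +_) (ℕ.+-suc (tri p) q)) (ℕ.+-suc ω _))))
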